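{- The logic ${\cal R}ing(0,+,*)$ is strictly weaker than the logic ${\cal R}ing(0,+,*,<)$: every sentence of ${\cal R}ing(0,+,*)$ is a sentence of ${\cal R}ing(0,+,*,<)$, and there exists a sentence $\theta$ of ${\cal R}ing(0,+,*,<)$ such that no sentence $\sigma$ of ${\cal R}ing(0,+,*)$ satisfies $\mathbb{Z}_m\models\sigma\iff\mathbb{Z}_m\models\theta$ for all integers $m\ge 1$.
   Context: For an integer $m\ge1$, $\mathbb{Z}_m$ is the finite residue class ring with universe $\{0,\ldots,m-1\}$ and addition and multiplication mod $m$. ${\cal R}ing(0,+,*)$ is the set of first-order formulas over a constant symbol $0$ and binary function symbols $+,*$, interpreted in $\mathbb{Z}_m$ as the residue class $0$ and addition and multiplication mod $m$. ${\cal R}ing(0,+,*,<)$ additionally has a binary relation symbol $<$ interpreted in $\mathbb{Z}_m$ as the natural order $0<1<\cdots<m-1$ of the representatives. -}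

module Defs where

open import Data.Bool using (Bool; true; false)
open import Data.Nat using (ℕ; zero; suc; NonZero)
import Data.Nat as ℕ
open import Data.Nat.DivMod using (_mod_)
open import Data.Fin using (Fin; toℕ; _<_)
import Data.Fin as F
open import Data.Product using (Σ; _×_)
open import Data.Sum using (_⊎_)
open import Data.Empty using (⊥)
open import Relation.Binary.PropositionalEquality using (_≡_)
open import Function.Bundles using (_⇔_)

data Term (n : ℕ) : Set where
  var  : Fin n → Term n
  zer  : Term n
  _⊕_  : Term n → Term n → Term n
  _⊗_  : Term n → Term n → Term n

-- First-order formulas.  The Bool index says whether the binary relation
-- symbol < is available: Formula false n = Ring(0,+,*),
-- Formula true n = Ring(0,+,*,<).
data Formula : Bool → ℕ → Set where
  _≐_   : ∀ {b n} → Term n → Term n → Formula b n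
  _≺_   : ∀ {n} → Term n → Term n → Formula true n
  ⊥f    : ∀ {b n} → Formula b n
  ¬f_   : ∀ {b n} → Formula b n → Formula b n
  _∧f_  : ∀ {b n} → Formula b n → Formula b n → Formula b n
  _∨f_  : ∀ {b n} → Formula b n → Formula b n → Formula b n
  _⇒f_  : ∀ {b n} → Formula b n → Formula b n → Formula b n
  ∃f    : ∀ {b n} → Formula b (suc n) → Formula b n
  ∀f    : ∀ {b n} → Formula b (suc n) → Formula b n

Sentence : Bool → Set
Sentence b = Formula b 0

embed : ∀ {n} → Formula false n → Formula true n
embed (s ≐ t)   = s ≐ t
embed ⊥f        = ⊥f
embed (¬f φ)    = ¬f embed φ
embed (φ ∧f ψ)  = embed φ ∧f embed ψ
embed (φ ∨f ψ)  = embed φ ∨f embed ψ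
embed (φ ⇒f ψ)  = embed φ ⇒f embed ψ
embed (∃f φ)    = ∃f (embed φ)
embed (∀f φ)    = ∀f (embed φ)

module Zmod (m : ℕ) .{{_ : NonZero m}} where
  addm : Fin m → Fin m → Fin m
  addm a b = (toℕ a ℕ.+ toℕ b) mod m

  mulm : Fin m → Fin m → Fin m
  mulm a b = (toℕ a ℕ.* toℕ b) mod m

  zerom : Fin m
  zerom = 0 mod m

  Env : ℕ → Set
  Env n = Fin n → Fin m

  extend : ∀ {n} → Fin m → Env n → Env (suc n)
  extend a ρ F.zero    = a
  extend a ρ (F.suc i) = ρ i

  evalT : ∀ {n} → Term n → Env n → Fin m
  evalT (var i) ρ = ρ i
  evalT zer     ρ = zerom
  evalT (s ⊕ t) ρ = addm (evalT s ρ) (evalT t ρ)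
  evalT (s ⊗ t) ρ = mulm (evalT s ρ) (evalT t ρ)

  sat : ∀ {b n} → Formula b n → Env n → Set
  sat (s ≐ t)  ρ = evalT s ρ ≡ evalT t ρ
  sat (s ≺ t)  ρ = evalT s ρ < evalT t ρ
  sat ⊥f       ρ = ⊥
  sat (¬f φ)   ρ = sat φ ρ → ⊥
  sat (φ ∧f ψ) ρ = sat φ ρ × sat ψ ρ
  sat (φ ∨f ψ) ρ = sat φ ρ ⊎ sat ψ ρ
  sat (φ ⇒f ψ) ρ = sat φ ρ → sat ψ ρ
  sat (∃f φ)   ρ = Σ (Fin m) λ a → sat φ (extend a ρ)
  sat (∀f φ)   ρ = (a : Fin m) → sat φ (extend a ρ)

  empty : Env 0
  empty ()

_⊨_ : (m : ℕ) .{{_ : NonZero m}} → ∀ {b} → Sentence b → Set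
m ⊨ σ = Zmod.sat m σ (Zmod.empty m)

{-# OPTIONS --safe #-}

-- Truth in a product ring Z_a × Z_b depends on Z_a only through finitely many
-- colours: every formula of Ring(0,+,*) comes with a finite colouring of the
-- pairs (a , assignment in Z_a) such that equally coloured factors can be
-- exchanged, whatever the other factor is.  For a quantifier the new colour is
-- the set of colours reached by extending the assignment.
-- Given a sentence σ, pigeonhole yields i < j such that 2^i + 1 and 2^j + 1 have
-- the same colour; by the Chinese remainder theorem σ then does not distinguish
-- m = (2^j + 1) 2^j from m′ = (2^i + 1) 2^j.  But m is a product of two
-- consecutive integers and m′ is not, and the order can express this.
module Submission where

open import Defs
open import Data.Bool using (true; false)
open import Data.Empty using (⊥-elim)
open import Data.Fin as Fin using (Fin; #_; toℕ; fromℕ<; combine; funToFin; finToFun)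
open import Data.Fin.Properties as Finₚ
  using (toℕ-fromℕ<; toℕ-injective; toℕ<n; combine-injective; finToFun-funToFin; pigeonhole)
open import Data.Nat
open import Data.Nat.Coprimality as Coprimality
  using (Coprime; coprime-divisor; coprime-Bézout; 1-coprimeTo)
open import Data.Nat.DivMod
open import Data.Nat.Divisibility
open import Data.Nat.GCD using (module Bézout)
open import Data.Nat.Properties
open import Data.Product using (Σ; ∃; _×_; _,_; proj₁; proj₂)
import Data.Product as Product
open import Data.Sum using (_⊎_; inj₁; inj₂)
import Data.Sum as Sum
open import Function.Bundles using (_⇔_; mk⇔; Equivalence)
open import Function.Construct.Identity using (⇔-id)
open import Function.Related.TypeIsomorphisms using (→-cong-⇔)
open import Data.Product.Function.NonDependent.Propositional using (_×-⇔_)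
open import Data.Sum.Function.Propositional using (_⊎-⇔_)
open import Relation.Binary.PropositionalEquality
open import Relation.Nullary using (¬_; Dec; yes; no)

private
  variable
    n : ℕ

-- Arithmetic

%≡%⇒∣∸ : ∀ x y d .{{_ : NonZero d}} → x % d ≡ y % d → d ∣ x ∸ y
%≡%⇒∣∸ x y d x≡y = divides (x / d ∸ y / d) (begin
  x ∸ y
    ≡⟨ cong₂ _∸_ (m≡m%n+[m/n]*n x d) (m≡m%n+[m/n]*n y d) ⟩
  (x % d + x / d * d) ∸ (y % d + y / d * d)
    ≡⟨ cong (λ r → (r + x / d * d) ∸ (y % d + y / d * d)) x≡y ⟩
  (y % d + x / d * d) ∸ (y % d + y / d * d)
    ≡⟨ [m+n]∸[m+o]≡n∸o (y % d) _ _ ⟩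
  x / d * d ∸ y / d * d
    ≡⟨ *-distribʳ-∸ d (x / d) (y / d) ⟨
  (x / d ∸ y / d) * d ∎)
  where open ≡-Reasoning

coprime-*-∣ : ∀ {a b k} → Coprime a b → a ∣ k → b ∣ k → a * b ∣ k
coprime-*-∣ {a} {b} c (divides q refl) b∣qa =
  subst (a * b ∣_) (*-comm a q)
    (*-monoʳ-∣ a (coprime-divisor (Coprimality.sym c) (subst (b ∣_) (*-comm q a) b∣qa)))

coprime-*ˡ : ∀ {m n k} → Coprime m k → Coprime n k → Coprime (m * n) k
coprime-*ˡ cm cn (d∣mn , d∣k) =
  cn (coprime-divisor (λ (e∣d , e∣m) → cm (e∣m , ∣-trans e∣d d∣k)) d∣mn , d∣k)

coprime-^ˡ : ∀ {m k} → Coprime m k → ∀ j → Coprime (m ^ j) k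
coprime-^ˡ {k = k} c zero    = 1-coprimeTo k
coprime-^ˡ         c (suc j) = coprime-*ˡ c (coprime-^ˡ c j)

coprime-1+ : ∀ {m n} → m ∣ n → Coprime m (suc n)
coprime-1+ {n = n} m∣n {d} (d∣m , d∣1+n) =
  ∣1⇒≡1 (∣m+n∣m⇒∣n (subst (d ∣_) (+-comm 1 n) d∣1+n) (∣-trans d∣m m∣n))

coprime-2-consecutive : ∀ n → Coprime 2 n ⊎ Coprime 2 (suc n)
coprime-2-consecutive zero    = inj₂ (coprime-1+ (2 ∣0))
coprime-2-consecutive (suc n) =
  Sum.swap (Sum.map₁ (λ c (d∣2 , d∣2+n) → c (d∣2 , ∣m+n∣m⇒∣n d∣2+n d∣2)) (coprime-2-consecutive n))

-- One of `n` and `suc n` is odd, hence coprime to `2 ^ j`, so the whole power divides the other.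
2^∣consecutive : ∀ j n → 2 ^ j ∣ suc n * n → 2 ^ j ∣ suc n ⊎ 2 ^ j ∣ n
2^∣consecutive j n 2^j∣ with coprime-2-consecutive n
... | inj₁ c = inj₁ (coprime-divisor (coprime-^ˡ c j) (subst (2 ^ j ∣_) (*-comm (suc n) n) 2^j∣))
... | inj₂ c = inj₂ (coprime-divisor (coprime-^ˡ c j) 2^j∣)

-- Chinese remainder theorem

-- A Bézout identity yields a representative of the idempotent (0 , 1) of Z_a × Z_b.
idempotent-residue : ∀ {a b} .{{_ : NonZero b}} → Coprime a b →
  ∃ λ e → a ∣ e × e % b ≡ 1 % b
idempotent-residue {a} {b} c with coprime-Bézout c
... | Bézout.+- x y 1+yb≡xa =
  x * a , n∣m*n x , trans (cong (_% b) (sym 1+yb≡xa)) ([m+kn]%n≡m%n 1 y b)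
... | Bézout.-+ x y 1+xa≡yb =
  -- Here `x * a` is -1 modulo `b`; squaring gives 1 without any subtraction.
  x * a * (x * a) , ∣m⇒∣m*n (x * a) (n∣m*n x) , (begin
    u * u % b             ≡⟨ %-remove-+ʳ (u * u) (n∣m*n y) ⟨
    (u * u + y * b) % b   ≡⟨ cong (λ z → (u * u + z) % b) 1+xa≡yb ⟨
    (u * u + suc u) % b   ≡⟨ cong (_% b) (+-suc (u * u) u) ⟩
    suc (u * u + u) % b   ≡⟨ cong (λ z → suc z % b) (trans (+-comm (u * u) u) (cong (_* u) 1+xa≡yb)) ⟩
    suc (y * b * u) % b   ≡⟨ %-remove-+ʳ 1 (∣m⇒∣m*n u (n∣m*n y)) ⟩
    1 % b                 ∎)
  where
  open ≡-Reasoning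
  u = x * a

%-absorb-1 : ∀ x e b .{{_ : NonZero b}} → e % b ≡ 1 % b → (x * e) % b ≡ x % b
%-absorb-1 x e b e≡1 = begin
  (x * e) % b               ≡⟨ %-distribˡ-* x e b ⟩
  ((x % b) * (e % b)) % b   ≡⟨ cong (λ z → ((x % b) * z) % b) e≡1 ⟩
  ((x % b) * (1 % b)) % b   ≡⟨ %-distribˡ-* x 1 b ⟨
  (x * 1) % b               ≡⟨ cong (_% b) (*-identityʳ x) ⟩
  x % b                     ∎
  where open ≡-Reasoning

chinese-remainder : ∀ {a b} .{{_ : NonZero a}} .{{_ : NonZero b}} → Coprime a b →
  ∀ x y → ∃ λ z → z % a ≡ x % a × z % b ≡ y % b
chinese-remainder {a} {b} c x y
  with e , a∣e , e≡1 ← idempotent-residue c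
     | f , b∣f , f≡1 ← idempotent-residue (Coprimality.sym c)
  = x * f + y * e
  , trans (%-remove-+ʳ (x * f) (∣n⇒∣m*n y a∣e)) (%-absorb-1 x f a f≡1)
  , trans (%-remove-+ˡ (y * e) (∣n⇒∣m*n x b∣f)) (%-absorb-1 y e b e≡1)

toℕ-mod : ∀ x d .{{_ : NonZero d}} → toℕ (x mod d) ≡ x % d
toℕ-mod x d = toℕ-fromℕ< (m%n<n x d)

-- Reduction to the factors of M = a * b

infix 4 _⟶[_]_
_⟶[_]_ : ∀ {M} → Fin M → (a : ℕ) .{{_ : NonZero a}} → Fin a → Set
x ⟶[ a ] y = toℕ x % a ≡ toℕ y

module _ {M a : ℕ} .{{_ : NonZero M}} .{{_ : NonZero a}} (a∣M : a ∣ M) where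

  mod-⟶ : ∀ x y → x % a ≡ y % a → x mod M ⟶[ a ] y mod a
  mod-⟶ x y x≡y = begin
    toℕ (x mod M) % a   ≡⟨ cong (_% a) (toℕ-mod x M) ⟩
    x % M % a           ≡⟨ m∣n⇒o%n%m≡o%m a M x a∣M ⟩
    x % a               ≡⟨ x≡y ⟩
    y % a               ≡⟨ toℕ-mod y a ⟨
    toℕ (y mod a)       ∎
    where open ≡-Reasoning

  -- Reduction modulo a divisor of `M` is a ring homomorphism, so it commutes with terms.
  evalT-⟶ : (ρ : Zmod.Env M n) (ρₐ : Zmod.Env a n) → (∀ i → ρ i ⟶[ a ] ρₐ i) →
            ∀ t → Zmod.evalT M t ρ ⟶[ a ] Zmod.evalT a t ρₐ
  evalT-⟶ ρ ρₐ h (var i) = h i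
  evalT-⟶ ρ ρₐ h zer     = mod-⟶ 0 0 refl
  evalT-⟶ ρ ρₐ h (s ⊕ t) = mod-⟶ _ _
    (trans (%-distribˡ-+ (toℕ (Zmod.evalT M s ρ)) (toℕ (Zmod.evalT M t ρ)) a)
           (cong₂ (λ x y → (x + y) % a) (evalT-⟶ ρ ρₐ h s) (evalT-⟶ ρ ρₐ h t)))
  evalT-⟶ ρ ρₐ h (s ⊗ t) = mod-⟶ _ _
    (trans (%-distribˡ-* (toℕ (Zmod.evalT M s ρ)) (toℕ (Zmod.evalT M t ρ)) a)
           (cong₂ (λ x y → (x * y) % a) (evalT-⟶ ρ ρₐ h s) (evalT-⟶ ρ ρₐ h t)))

toℕ-% : ∀ {d} .{{_ : NonZero d}} (x : Fin d) → toℕ x % d ≡ toℕ x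
toℕ-% x = m<n⇒m%n≡m (toℕ<n x)

record Factorization (M a b : ℕ) : Set where
  field
    product : M ≡ a * b
    coprime : Coprime a b

  left∣ : a ∣ M
  left∣ = subst (a ∣_) (sym product) (m∣m*n b)

  right∣ : b ∣ M
  right∣ = subst (b ∣_) (sym product) (n∣m*n a)

  jointly-∣ : ∀ {k} → a ∣ k → b ∣ k → M ∣ k
  jointly-∣ {k} a∣k b∣k = subst (_∣ k) (sym product) (coprime-*-∣ coprime a∣k b∣k)

module _ {M a b : ℕ} .{{_ : NonZero M}} .{{_ : NonZero a}} .{{_ : NonZero b}}
         (F : Factorization M a b) where
  open Factorization F

  -- Otherwise `x ∸ y` would be a positive multiple of `M` below `M`. Truncated subtraction sees
  -- only one direction; antisymmetry then gives injectivity.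
  jointly-≤ : ∀ x y → x < M → x % a ≡ y % a → x % b ≡ y % b → x ≤ y
  jointly-≤ x y x<M x≡ₐy x≡ᵦy with x ∸ y in eq
  ... | zero = m∸n≡0⇒m≤n eq
  ... | suc d = ⊥-elim (<⇒≱ x<M (begin
    M     ≤⟨ ∣⇒≤ (jointly-∣ (subst (a ∣_) eq (%≡%⇒∣∸ x y a x≡ₐy)) (subst (b ∣_) eq (%≡%⇒∣∸ x y b x≡ᵦy))) ⟩
    suc d ≡⟨ eq ⟨
    x ∸ y ≤⟨ m∸n≤m x y ⟩
    x     ∎))
    where open ≤-Reasoning

  jointly-injective : ∀ {x y : Fin M} → toℕ x % a ≡ toℕ y % a → toℕ x % b ≡ toℕ y % b → x ≡ y
  jointly-injective {x} {y} x≡ₐy x≡ᵦy = toℕ-injective (≤-antisym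
    (jointly-≤ _ _ (toℕ<n x) x≡ₐy x≡ᵦy)
    (jointly-≤ _ _ (toℕ<n y) (sym x≡ₐy) (sym x≡ᵦy)))

  jointly-surjective : ∀ (u : Fin a) (v : Fin b) → ∃ λ (x : Fin M) → x ⟶[ a ] u × x ⟶[ b ] v
  jointly-surjective u v
    with z , z≡u , z≡v ← chinese-remainder coprime (toℕ u) (toℕ v)
    = z mod M , lift left∣ u z≡u , lift right∣ v z≡v
    where
    lift : ∀ {d} .{{_ : NonZero d}} → d ∣ M → (w : Fin d) → z % d ≡ toℕ w % d → z mod M ⟶[ d ] w
    lift {d} d∣M w z≡w = trans (mod-⟶ d∣M z (toℕ w) z≡w) (trans (toℕ-mod (toℕ w) d) (toℕ-% w))

  Splits : Zmod.Env M n → Zmod.Env a n → Zmod.Env b n → Set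
  Splits ρ ρₐ ρᵦ = (∀ i → ρ i ⟶[ a ] ρₐ i) × (∀ i → ρ i ⟶[ b ] ρᵦ i)

  splits-extend : ∀ {ρ : Zmod.Env M n} {ρₐ ρᵦ} {x u v} →
    x ⟶[ a ] u → x ⟶[ b ] v → Splits ρ ρₐ ρᵦ →
    Splits (Zmod.extend M x ρ) (Zmod.extend a u ρₐ) (Zmod.extend b v ρᵦ)
  splits-extend x⟶u x⟶v (hₐ , hᵦ) =
    (λ { Fin.zero → x⟶u ; (Fin.suc i) → hₐ i }) , (λ { Fin.zero → x⟶v ; (Fin.suc i) → hᵦ i })

  residue : ∀ {d} .{{_ : NonZero d}} (x : Fin M) → x ⟶[ d ] toℕ x mod d
  residue {d} x = sym (toℕ-mod (toℕ x) d)

  -- Term values commute with both reductions, and an element of Z_M is determined by its two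
  -- residues.
  ≐⇔components : ∀ {ρ : Zmod.Env M n} {ρₐ ρᵦ} → Splits ρ ρₐ ρᵦ → ∀ s t →
    Zmod.evalT M s ρ ≡ Zmod.evalT M t ρ ⇔
    (Zmod.evalT a s ρₐ ≡ Zmod.evalT a t ρₐ × Zmod.evalT b s ρᵦ ≡ Zmod.evalT b t ρᵦ)
  ≐⇔components {ρ = ρ} {ρₐ} {ρᵦ} (hₐ , hᵦ) s t = mk⇔
    (λ eq → component left∣ ρₐ hₐ eq , component right∣ ρᵦ hᵦ eq)
    (λ (eqₐ , eqᵦ) → jointly-injective (agree left∣ ρₐ hₐ eqₐ) (agree right∣ ρᵦ hᵦ eqᵦ))
    where
    module _ {d : ℕ} .{{_ : NonZero d}} (d∣M : d ∣ M) (ρ′ : Zmod.Env d _)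
             (h : ∀ i → ρ i ⟶[ d ] ρ′ i) where
      component : Zmod.evalT M s ρ ≡ Zmod.evalT M t ρ → Zmod.evalT d s ρ′ ≡ Zmod.evalT d t ρ′
      component eq = toℕ-injective (trans (sym (evalT-⟶ d∣M ρ ρ′ h s))
        (trans (cong (λ x → toℕ x % d) eq) (evalT-⟶ d∣M ρ ρ′ h t)))

      agree : Zmod.evalT d s ρ′ ≡ Zmod.evalT d t ρ′ →
              toℕ (Zmod.evalT M s ρ) % d ≡ toℕ (Zmod.evalT M t ρ) % d
      agree eq = trans (evalT-⟶ d∣M ρ ρ′ h s) (trans (cong toℕ eq) (sym (evalT-⟶ d∣M ρ ρ′ h t)))

-- Finite colourings

-- `size` is fixed before any modulus is, which is what makes pigeonhole over the moduli possible.
-- One direction of `exchange` suffices, because the two sides can be swapped.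
record Colouring (φ : Formula false n) : Set where
  field
    size     : ℕ
    colour   : ∀ a .{{_ : NonZero a}} → Zmod.Env a n → Fin size
    exchange : ∀ {M M′ a a′ b} .{{_ : NonZero M}} .{{_ : NonZero M′}}
                 .{{_ : NonZero a}} .{{_ : NonZero a′}} .{{_ : NonZero b}}
               (F : Factorization M a b) (F′ : Factorization M′ a′ b)
               {ρ : Zmod.Env M n} {ρ′ : Zmod.Env M′ n}
               {ρₐ : Zmod.Env a n} {ρₐ′ : Zmod.Env a′ n} {ρᵦ : Zmod.Env b n} →
               Splits F ρ ρₐ ρᵦ → Splits F′ ρ′ ρₐ′ ρᵦ → colour a ρₐ ≡ colour a′ ρₐ′ →
               Zmod.sat M φ ρ → Zmod.sat M′ φ ρ′

bit : ∀ {p} {P : Set p} → Dec P → Fin 2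
bit (yes _) = Fin.suc Fin.zero
bit (no _)  = Fin.zero

bit-transfer : ∀ {p q} {P : Set p} {Q : Set q} (P? : Dec P) (Q? : Dec Q) →
               bit P? ≡ bit Q? → P → Q
bit-transfer _       (yes q) _  _ = q
bit-transfer (no ¬p) (no _)  _  p = ⊥-elim (¬p p)
bit-transfer (yes _) (no _)  () _

≐-colouring : (s t : Term n) → Colouring (s ≐ t)
≐-colouring s t = record
  { size     = 2
  ; colour   = λ a ρ → bit (Zmod.evalT a s ρ Finₚ.≟ Zmod.evalT a t ρ)
  ; exchange = λ F F′ h h′ eq p →
      Equivalence.from (≐⇔components F′ h′ s t)
        (Product.map₁ (bit-transfer (_ Finₚ.≟ _) (_ Finₚ.≟ _) eq)
          (Equivalence.to (≐⇔components F h s t) p))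
  }

module _ {φ ψ : Formula false n} (Cφ : Colouring φ) (Cψ : Colouring ψ) where
  private
    module Cφ = Colouring Cφ
    module Cψ = Colouring Cψ

  pairColour : ∀ a .{{_ : NonZero a}} → Zmod.Env a n → Fin (Cφ.size * Cψ.size)
  pairColour a ρ = combine (Cφ.colour a ρ) (Cψ.colour a ρ)

  module _ {a a′} .{{_ : NonZero a}} .{{_ : NonZero a′}} {ρ : Zmod.Env a n} {ρ′ : Zmod.Env a′ n}
           (eq : pairColour a ρ ≡ pairColour a′ ρ′) where
    pairColour₁ : Cφ.colour a ρ ≡ Cφ.colour a′ ρ′
    pairColour₁ = proj₁ (combine-injective _ (Cψ.colour a ρ) _ _ eq)

    pairColour₂ : Cψ.colour a ρ ≡ Cψ.colour a′ ρ′
    pairColour₂ = proj₂ (combine-injective (Cφ.colour a ρ) _ _ _ eq)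

  ∧-colouring : Colouring (φ ∧f ψ)
  ∧-colouring = record
    { colour   = pairColour
    ; exchange = λ F F′ h h′ eq →
        Product.map (Cφ.exchange F F′ h h′ (pairColour₁ eq)) (Cψ.exchange F F′ h h′ (pairColour₂ eq))
    }

  ∨-colouring : Colouring (φ ∨f ψ)
  ∨-colouring = record
    { colour   = pairColour
    ; exchange = λ F F′ h h′ eq →
        Sum.map (Cφ.exchange F F′ h h′ (pairColour₁ eq)) (Cψ.exchange F F′ h h′ (pairColour₂ eq))
    }

  ⇒-colouring : Colouring (φ ⇒f ψ)
  ⇒-colouring = record
    { colour   = pairColour
    ; exchange = λ F F′ h h′ eq f p →
        -- The premise is contravariant: it is carried back from `M′` to `M` by the swapped
        -- exchange.
        Cψ.exchange F F′ h h′ (pairColour₂ eq) (f (Cφ.exchange F′ F h′ h (sym (pairColour₁ eq)) p))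
    }

-- Colourings of quantified formulas

module _ {φ : Formula false (suc n)} (C : Colouring φ) where
  open Colouring C

  Reached : ∀ a .{{_ : NonZero a}} → Zmod.Env a n → Fin size → Set
  Reached a ρ k = ∃ λ u → colour a (Zmod.extend a u ρ) ≡ k

  reached? : ∀ a .{{_ : NonZero a}} (ρ : Zmod.Env a n) k → Dec (Reached a ρ k)
  reached? a ρ k = Finₚ.any? (λ u → colour a (Zmod.extend a u ρ) Finₚ.≟ k)

  -- Coding a set of colours by its characteristic function keeps the new palette finite, with a
  -- size independent of `a`.
  reachedSet : ∀ a .{{_ : NonZero a}} → Zmod.Env a n → Fin (2 ^ size)
  reachedSet a ρ = funToFin (λ k → bit (reached? a ρ k))

  -- The colour of the extension by `u` is reached in Z_a by `u` itself, so its bit is set in the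
  -- common code, and this bit yields a witness in Z_a′.
  same-reached : ∀ {a a′} .{{_ : NonZero a}} .{{_ : NonZero a′}}
    {ρ : Zmod.Env a n} {ρ′ : Zmod.Env a′ n} → reachedSet a ρ ≡ reachedSet a′ ρ′ →
    ∀ u → ∃ λ u′ → colour a′ (Zmod.extend a′ u′ ρ′) ≡ colour a (Zmod.extend a u ρ)
  same-reached {a} {a′} {ρ} {ρ′} eq u =
    bit-transfer (reached? a ρ k) (reached? a′ ρ′ k)
      (trans (sym (finToFun-funToFin _ k))
        (trans (cong (λ c → finToFun c k) eq) (finToFun-funToFin _ k)))
      (u , refl)
    where k = colour a (Zmod.extend a u ρ)

  -- The back-and-forth step: split `x` into its residues, replace the one modulo `a` by an equally
  -- coloured one modulo `a′`, keep the one modulo `b`, and recombine by the Chinese remainder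
  -- theorem.
  partner : ∀ {M M′ a a′ b} .{{_ : NonZero M}} .{{_ : NonZero M′}}
    .{{_ : NonZero a}} .{{_ : NonZero a′}} .{{_ : NonZero b}}
    (F : Factorization M a b) (F′ : Factorization M′ a′ b)
    {ρ : Zmod.Env M n} {ρ′ : Zmod.Env M′ n}
    {ρₐ : Zmod.Env a n} {ρₐ′ : Zmod.Env a′ n} {ρᵦ : Zmod.Env b n} →
    Splits F ρ ρₐ ρᵦ → Splits F′ ρ′ ρₐ′ ρᵦ → reachedSet a ρₐ ≡ reachedSet a′ ρₐ′ →
    ∀ x → ∃ λ x′ →
      (Zmod.sat M φ (Zmod.extend M x ρ) → Zmod.sat M′ φ (Zmod.extend M′ x′ ρ′)) ×
      (Zmod.sat M′ φ (Zmod.extend M′ x′ ρ′) → Zmod.sat M φ (Zmod.extend M x ρ))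
  partner {M} {M′} {a} {a′} {b} F F′ h h′ eq x =
    let u′ , same = same-reached eq (toℕ x mod a)
        x′ , x′⟶u′ , x′⟶v = jointly-surjective F′ u′ (toℕ x mod b)
        g  = splits-extend F (residue F x) (residue F x) h
        g′ = splits-extend F′ x′⟶u′ x′⟶v h′
    in x′ , exchange F F′ g g′ (sym same) , exchange F′ F g′ g same

  ∃-colouring : Colouring (∃f φ)
  ∃-colouring = record
    { colour   = reachedSet
    ; exchange = λ F F′ h h′ eq (x , p) →
        let x′ , to , _ = partner F F′ h h′ eq x in x′ , to p
    }

  ∀-colouring : Colouring (∀f φ)
  ∀-colouring = record
    { colour   = reachedSet
    ; exchange = λ F F′ h h′ eq f x′ →
        -- The given element lies in Z_M′, so its partner is sought in Z_M and truth is carried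
        -- back.
        let x , _ , from = partner F′ F h′ h (sym eq) x′ in from (f x)
    }

⊥-colouring : Colouring {n} ⊥f
⊥-colouring = record { size = 1 ; colour = λ _ _ → Fin.zero ; exchange = λ _ _ _ _ _ p → p }

¬-colouring : {φ : Formula false n} → Colouring φ → Colouring (¬f φ)
¬-colouring C = record
  { colour   = colour
  ; exchange = λ F F′ h h′ eq ¬p p → ¬p (exchange F′ F h′ h (sym eq) p)
  }
  where open Colouring C

colouring : (φ : Formula false n) → Colouring φ
colouring (s ≐ t)  = ≐-colouring s t
colouring ⊥f       = ⊥-colouring
colouring (¬f φ)   = ¬-colouring (colouring φ)
colouring (φ ∧f ψ) = ∧-colouring (colouring φ) (colouring ψ)
colouring (φ ∨f ψ) = ∨-colouring (colouring φ) (colouring ψ)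
colouring (φ ⇒f ψ) = ⇒-colouring (colouring φ) (colouring ψ)
colouring (∃f φ)   = ∃-colouring (colouring φ)
colouring (∀f φ)   = ∀-colouring (colouring φ)

-- Being a product of two consecutive integers

-- Expresses that the additive order of variable y is at least the value of variable x.
annihilator≥ : Fin n → Fin n → Formula true n
annihilator≥ x y =
  ∀f ((var Fin.zero ≺ var (Fin.suc x)) ⇒f
     (((var Fin.zero ⊗ var (Fin.suc y)) ≐ zer) ⇒f (var Fin.zero ≐ zer)))

-- For e = f + 1 with e f ≡ 0, the order conditions force e f = m.
pronic : Sentence true
pronic = ∃f (∃f (
  (zer ≺ f) ∧f ((f ≺ e)
  -- Under the new quantifier `# 1` is `f` and `# 2` is `e`: nothing lies strictly between them.
  ∧f ((¬f ∃f ((var (# 1) ≺ var (# 0)) ∧f (var (# 0) ≺ var (# 2))))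
  ∧f (((e ⊗ f) ≐ zer)
  ∧f (annihilator≥ (# 0) (# 1) ∧f annihilator≥ (# 1) (# 0)))))))
  where
  e f : Term 2
  e = var (# 1)
  f = var (# 0)

module _ {M : ℕ} .{{_ : NonZero M}} where
  open Zmod M

  toℕ-zerom : toℕ zerom ≡ 0
  toℕ-zerom = trans (toℕ-mod 0 M) (n∣m⇒m%n≡0 0 M (M ∣0))

  mod≡zerom⇒∣ : ∀ k → k mod M ≡ zerom → M ∣ k
  mod≡zerom⇒∣ k eq =
    m%n≡0⇒n∣m k M (trans (sym (toℕ-mod k M)) (trans (cong toℕ eq) toℕ-zerom))

  ∣⇒mod≡zerom : ∀ k → M ∣ k → k mod M ≡ zerom
  ∣⇒mod≡zerom k M∣k =
    toℕ-injective (trans (toℕ-mod k M) (trans (n∣m⇒m%n≡0 k M M∣k) (sym toℕ-zerom)))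

  -- Below `M` the product does not wrap around, so it vanishes already as a natural number.
  mulm-zero⇒zero : ∀ x k → 0 < k → toℕ x * k < M → (toℕ x * k) mod M ≡ zerom → x ≡ zerom
  mulm-zero⇒zero x k@(suc _) _ xk<M eq = toℕ-injective (trans
    (m*n≡0⇒m≡0 (toℕ x) k (xk≡0 (mod≡zerom⇒∣ _ eq))) (sym toℕ-zerom))
    where
    xk≡0 : M ∣ toℕ x * k → toℕ x * k ≡ 0
    xk≡0 M∣ = trans (sym (m<n⇒m%n≡m xk<M)) (n∣m⇒m%n≡0 _ M M∣)

  -- Take `e` = k + 1 and `f` = k. Products `y * e` with `y < f`, and `y * f` with `y < e`, stay
  -- below `M`, so no wrap-around occurs. The bound `1 < k` ensures that k + 1 is a residue below
  -- `M`.
  consecutive-product⊨pronic : ∀ k → 1 < k → M ≡ suc k * k → M ⊨ pronic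
  consecutive-product⊨pronic k 1<k M≡ =
    e , f ,
    subst₂ _<_ (sym toℕ-zerom) (sym toℕ-f) (<-trans z<s 1<k) ,
    subst₂ _<_ (sym toℕ-f) (sym toℕ-e) ≤-refl ,
    (λ (z , f<z , z<e) → <⇒≱ (subst (_< toℕ z) toℕ-f f<z) (m<1+n⇒m≤n (subst (toℕ z <_) toℕ-e z<e))) ,
    ∣⇒mod≡zerom _ (∣-reflexive (trans M≡ (sym (cong₂ _*_ toℕ-e toℕ-f)))) ,
    (λ y y<f → mulm-zero⇒zero y (toℕ e) (subst (0 <_) (sym toℕ-e) z<s)
      (subst₂ _<_ (cong (toℕ y *_) (sym toℕ-e)) (trans (*-comm k (suc k)) (sym M≡))
        (*-monoˡ-< (suc k) (subst (toℕ y <_) toℕ-f y<f)))) ,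
    (λ y y<e → mulm-zero⇒zero y (toℕ f) (subst (0 <_) (sym toℕ-f) (<-trans z<s 1<k))
      (subst₂ _<_ (cong (toℕ y *_) (sym toℕ-f)) (sym M≡)
        (*-monoˡ-< k {{>-nonZero (<-trans z<s 1<k)}} (subst (toℕ y <_) toℕ-e y<e))))
    where
    1+k<M : suc k < M
    1+k<M = subst (suc k <_) (sym M≡) (m<m*n (suc k) k 1<k)
    e f : Fin M
    e = fromℕ< 1+k<M
    f = fromℕ< (<-trans (n<1+n k) 1+k<M)
    toℕ-e : toℕ e ≡ suc k
    toℕ-e = toℕ-fromℕ< 1+k<M
    toℕ-f : toℕ f ≡ k
    toℕ-f = toℕ-fromℕ< (<-trans (n<1+n k) 1+k<M)

  -- One of the two consecutive factors e, f would be divisible by 2 ^ j, hence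
  -- annihilated by a, which is too small.
  a*2^j⊭pronic : ∀ a j → 0 < a → suc a < 2 ^ j → M ≡ a * 2 ^ j → ¬ (M ⊨ pronic)
  a*2^j⊭pronic a j 0<a 1+a<2^j M≡ (e , f , 0<f , f<e , no-gap , ef≡0 , min-e , min-f) =
    -- If `2 ^ j` divides `e`, then a + 1 < 2 ^ j ≤ f + 1 gives `a < f`; if it divides `f`, then a <
    -- 2 ^ j ≤ f < e. Either way `a` lies within the range of an order condition.
    Sum.[ (λ 2^j∣1+f → impossible e (subst (2 ^ j ∣_) (sym e≡1+f) 2^j∣1+f)
             (min-e (fromℕ< a<M) (subst (_< toℕ f) (sym toℕ-a) (s<s⁻¹ (<-≤-trans 1+a<2^j (∣⇒≤ 2^j∣1+f))))))
        , (λ 2^j∣f → impossible f 2^j∣f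
             (min-f (fromℕ< a<M) (subst (_< toℕ e) (sym toℕ-a)
               (<-trans (<-≤-trans a<2^j (∣⇒≤ {{>-nonZero (subst (_< toℕ f) toℕ-zerom 0<f)}} 2^j∣f)) f<e))))
        ] (2^∣consecutive j (toℕ f) 2^j∣)
    where
    a<2^j : a < 2 ^ j
    a<2^j = <-trans (n<1+n a) 1+a<2^j
    a<M : a < M
    a<M = subst (a <_) (sym M≡) (<-≤-trans a<2^j (m≤n*m (2 ^ j) a {{>-nonZero 0<a}}))
    toℕ-a : toℕ (fromℕ< a<M) ≡ a
    toℕ-a = toℕ-fromℕ< a<M
    -- Otherwise f + 1 would itself fill the gap between `f` and `e`.
    e≡1+f : toℕ e ≡ suc (toℕ f)
    e≡1+f = ≤-antisym (≮⇒≥ (λ 1+f<e →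
      let 1+f<M = <-trans 1+f<e (toℕ<n e)
          toℕ-1+f = toℕ-fromℕ< 1+f<M
      in no-gap (fromℕ< 1+f<M , subst (toℕ f <_) (sym toℕ-1+f) ≤-refl
                              , subst (_< toℕ e) (sym toℕ-1+f) 1+f<e))) f<e
    2^j∣ : 2 ^ j ∣ suc (toℕ f) * toℕ f
    2^j∣ = subst (λ k → 2 ^ j ∣ k * toℕ f) e≡1+f
      (∣-trans (subst (2 ^ j ∣_) (sym M≡) (n∣m*n a)) (mod≡zerom⇒∣ _ ef≡0))
    -- `a` times a multiple of `2 ^ j` is a multiple of `M`, so the order condition would make `a`
    -- zero.
    impossible : ∀ x → 2 ^ j ∣ toℕ x →
      ((toℕ (fromℕ< a<M) * toℕ x) mod M ≡ zerom → fromℕ< a<M ≡ zerom) → _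
    impossible x 2^j∣x annihilator⇒0 = <⇒≢ 0<a (sym (trans (sym toℕ-a)
      (trans (cong toℕ (annihilator⇒0 (∣⇒mod≡zerom _
        (subst₂ _∣_ (sym M≡) (cong (_* toℕ x) (sym toℕ-a)) (*-monoʳ-∣ a 2^j∣x))))) toℕ-zerom)))

-- The exponent is shifted so that oddFactor i + 1 < 2 ^ (2 + j) for i < j.
oddFactor : ℕ → ℕ
oddFactor i = suc (2 ^ (2 + i))

oddFactor-coprime-2^ : ∀ i j → Coprime (oddFactor i) (2 ^ j)
oddFactor-coprime-2^ i j = Coprimality.sym (coprime-^ˡ (coprime-1+ (m∣m*n (2 ^ suc i))) j)

-- Since 2 < 2 ^ (2 + i), adding 2 to that power stays below its double.
1+oddFactor<2^ : ∀ {i j} → i < j → suc (oddFactor i) < 2 ^ (2 + j)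
1+oddFactor<2^ {i} {j} i<j = begin-strict
  2 + 2 ^ (2 + i)             <⟨ +-monoˡ-< (2 ^ (2 + i)) (<-≤-trans 2<4 4≤2^) ⟩
  2 ^ (2 + i) + 2 ^ (2 + i)   ≡⟨ cong (2 ^ (2 + i) +_) (+-identityʳ _) ⟨
  2 ^ (3 + i)                 ≤⟨ ^-monoʳ-≤ 2 (s≤s (s≤s i<j)) ⟩
  2 ^ (2 + j)                 ∎
  where
  open ≤-Reasoning
  2<4 : 2 < 4
  2<4 = s≤s (s≤s (s≤s z≤n))
  4≤2^ : 4 ≤ 2 ^ (2 + i)
  4≤2^ = ^-monoʳ-≤ 2 (m≤m+n 2 i)

-- Undefinability without the order

pronic-undefinable : ¬ Σ (Sentence false) (λ σ → (k : ℕ) → (suc k ⊨ σ) ⇔ (suc k ⊨ pronic))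
pronic-undefinable (σ , σ⇔pronic)
  with i , j , i<j , same ← pigeonhole (n<1+n (Colouring.size (colouring σ)))
         (λ i → Colouring.colour (colouring σ) (oddFactor (toℕ i)) (Zmod.empty (oddFactor (toℕ i))))
  -- The odd factor for `j` is b + 1, so `pronic` holds modulo (b + 1) * b. It passes to `σ`,
  -- through the exchange of odd factors, and back to `pronic` at the other modulus. With no free
  -- variables, both splittings are vacuous.
  = a*2^j⊭pronic (oddFactor (toℕ i)) (2 + toℕ j) z<s (1+oddFactor<2^ i<j) (product (F i))
      (to (σ⇔pronic _) (exchange (F j) (F i) {ρᵦ = Zmod.empty b} ((λ ()) , (λ ())) ((λ ()) , (λ ())) (sym same)
        (from (σ⇔pronic _) (consecutive-product⊨pronic b 1<b (product (F j))))))
  where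
  open Equivalence
  open Colouring (colouring σ)
  open Factorization
  b = 2 ^ (2 + toℕ j)
  instance
    b-nonZero : NonZero b
    b-nonZero = m^n≢0 2 (2 + toℕ j)
  1<b : 1 < b
  1<b = ^-monoʳ-< 2 ≤-refl {0} {2 + toℕ j} z<s
  -- The modulus is written as a successor because the hypothesis on `σ` speaks of moduli `suc k`.
  F : ∀ i → Factorization (suc (pred (oddFactor (toℕ i) * b))) (oddFactor (toℕ i)) b
  F i = record
    { product = suc-pred _ {{m*n≢0 (oddFactor (toℕ i)) b}}
    ; coprime = oddFactor-coprime-2^ (toℕ i) (2 + toℕ j)
    }

-- Inclusion of the logics

embed-⇔ : ∀ M .{{_ : NonZero M}} (φ : Formula false n) (ρ : Zmod.Env M n) →
          Zmod.sat M φ ρ ⇔ Zmod.sat M (embed φ) ρ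
embed-⇔ M (s ≐ t)  ρ = ⇔-id _
embed-⇔ M ⊥f       ρ = ⇔-id _
embed-⇔ M (¬f φ)   ρ = →-cong-⇔ (embed-⇔ M φ ρ) (⇔-id _)
embed-⇔ M (φ ∧f ψ) ρ = embed-⇔ M φ ρ ×-⇔ embed-⇔ M ψ ρ
embed-⇔ M (φ ∨f ψ) ρ = embed-⇔ M φ ρ ⊎-⇔ embed-⇔ M ψ ρ
embed-⇔ M (φ ⇒f ψ) ρ = →-cong-⇔ (embed-⇔ M φ ρ) (embed-⇔ M ψ ρ)
embed-⇔ M (∃f φ)   ρ = mk⇔ (Product.map₂ (λ {x} → to (embed-⇔ M φ (Zmod.extend M x ρ))))
                           (Product.map₂ (λ {x} → from (embed-⇔ M φ (Zmod.extend M x ρ))))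
  where open Equivalence
embed-⇔ M (∀f φ)   ρ = mk⇔ (λ p x → to (embed-⇔ M φ (Zmod.extend M x ρ)) (p x))
                           (λ p x → from (embed-⇔ M φ (Zmod.extend M x ρ)) (p x))
  where open Equivalence

theorem5p19 : ((σ : Sentence false) → (m : ℕ) → (suc m ⊨ σ) ⇔ (suc m ⊨ embed σ))
    × Σ (Sentence true) (λ θ →
    ¬ Σ (Sentence false) (λ σ → (m : ℕ) → (suc m ⊨ σ) ⇔ (suc m ⊨ θ)))
theorem5p19 = (λ σ m → embed-⇔ (suc m) σ (Zmod.empty (suc m))) , pronic , pronic-undefinable
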